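{- Let $G$ be an affine game. Then $G\geqslant 0$ if and only if $G\in\mathcal L\cup\mathcal P$.
   Context: Affine games are defined recursively. There are two games without options, denoted $\infty$ and $\overline{\infty}$ (terminating games). Every other affine game is a form $G=\{G^{\mathcal L}\mid G^{\mathcal R}\}$, where $G^{\mathcal L}$ (Left options) and $G^{\mathcal R}$ (Right options) are non-empty finite sets of previously constructed affine games. Let $\mathbb A$ be the set of all affine games. The game $0$ is $\{\overline\infty\mid\infty\}$. Disjunctive sum: $G+H$ is undefined if one of $G,H$ is the form $\infty$ and the other is $\overline\infty$; it is $\infty$ if one is $\infty$ and the other is not $\overline\infty$; it is $\overline\infty$ if one is $\overline\infty$ and the other is not $\infty$; otherwise $G+H=\{G^{\mathcal L}+H,\,G+H^{\mathcal L}\mid G^{\mathcal R}+H,\,G+H^{\mathcal R}\}$. Outcomes: $o^L(G)=\mathbf L$ if $G=\infty$ or some $G^L\in G^{\mathcal L}$ has $o^R(G^L)=\mathbf L$, and $o^L(G)=\mathbf R$ otherwise; $o^R(G)=\mathbf R$ if $G=\overline\infty$ or some $G^R\in G^{\mathcal R}$ has $o^L(G^R)=\mathbf R$, and $o^R(G)=\mathbf L$ otherwise. With $\mathbf L>\mathbf R$, the outcome is $o(G)=(o^L(G),o^R(G))$, ordered componentwise. $\mathcal L,\mathcal N,\mathcal P,\mathcal R$ are the classes of games with outcome $(\mathbf L,\mathbf L)$, $(\mathbf L,\mathbf R)$, $(\mathbf R,\mathbf L)$, $(\mathbf R,\mathbf R)$, respectively. Order: $G\geqslant H$ iff $o(G+X)\geqslant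 o(H+X)$ for all $X\in\mathbb A\setminus\{\infty,\overline\infty\}$. -}

module Defs where

open import Data.Bool.Base using (if_then_else_)
open import Data.Empty using (⊥-elim-irr)
open import Data.Fin.Properties using (any?)
open import Data.Nat.Base using (ℕ; suc)
open import Data.Product.Base using (_×_; _,_)
open import Data.Product.Relation.Binary.Pointwise.NonDependent using (Pointwise)
open import Data.Vec.Functional using (Vector; replicate; _++_)
open import Level using (0ℓ)
open import Relation.Binary.Definitions using (DecidableEquality)
open import Relation.Binary.PropositionalEquality.Core using (_≡_; _≢_; refl)
open import Relation.Nullary.Decidable.Core using (yes; no; ⌊_⌋)
open import Relation.Nullary.Negation.Core using (¬_)
open import Relation.Unary using (Pred)

infix  4 _≟_ _≥ʳ_ _≥ᵒ_ _≥_
infixl 6 _+_[_]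

-- A finite non-empty set of options is given by an enumeration
-- Fin (suc n) → Game, possibly with repetitions.  Forms with the same sets
-- of options are not identified, but outcomes, and hence the order, depend
-- only on which options occur.
data Game : Set where
  ∞ ∞̄   : Game
  ⟨_∣_⟩ : {m n : ℕ} (Gᴸ : Vector Game (suc m)) (Gᴿ : Vector Game (suc n)) → Game

𝟎 : Game
𝟎 = ⟨ replicate 1 ∞̄ ∣ replicate 1 ∞ ⟩

data Undefined : Game → Game → Set where
  ∞+∞̄ : Undefined ∞ ∞̄
  ∞̄+∞ : Undefined ∞̄ ∞

Defined : Game → Game → Set
Defined G H = ¬ Undefined G H

_+_[_] : (G H : Game) → .(Defined G H) → Game
∞ + ∞̄ [ d ] = ⊥-elim-irr (d ∞+∞̄)
∞̄ + ∞ [ d ] = ⊥-elim-irr (d ∞̄+∞)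
∞ + ∞ [ _ ] = ∞
∞ + ⟨ _ ∣ _ ⟩ [ _ ] = ∞
⟨ _ ∣ _ ⟩ + ∞ [ _ ] = ∞
∞̄ + ∞̄ [ _ ] = ∞̄
∞̄ + ⟨ _ ∣ _ ⟩ [ _ ] = ∞̄
⟨ _ ∣ _ ⟩ + ∞̄ [ _ ] = ∞̄
G@(⟨ Gᴸ ∣ Gᴿ ⟩) + H@(⟨ Hᴸ ∣ Hᴿ ⟩) [ _ ] =
  ⟨ (λ i → Gᴸ i + H [ (λ ()) ]) ++ (λ j → G + Hᴸ j [ (λ ()) ])
  ∣ (λ i → Gᴿ i + H [ (λ ()) ]) ++ (λ j → G + Hᴿ j [ (λ ()) ]) ⟩

data Result : Set where
  𝐋 𝐑 : Result

_≟_ : DecidableEquality Result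
𝐋 ≟ 𝐋 = yes refl
𝐋 ≟ 𝐑 = no λ ()
𝐑 ≟ 𝐋 = no λ ()
𝐑 ≟ 𝐑 = yes refl

data _≥ʳ_ : Result → Result → Set where
  ≥ʳ-refl : ∀ {r} → r ≥ʳ r
  𝐋≥𝐑    : 𝐋 ≥ʳ 𝐑

mutual
  oᴸ : Game → Result
  oᴸ ∞           = 𝐋
  oᴸ ∞̄           = 𝐑
  oᴸ ⟨ Gᴸ ∣ _  ⟩ = if ⌊ any? (λ i → oᴿ (Gᴸ i) ≟ 𝐋) ⌋ then 𝐋 else 𝐑

  oᴿ : Game → Result
  oᴿ ∞           = 𝐋
  oᴿ ∞̄           = 𝐑
  oᴿ ⟨ _  ∣ Gᴿ ⟩ = if ⌊ any? (λ i → oᴸ (Gᴿ i) ≟ 𝐑) ⌋ then 𝐑 else 𝐋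

Outcome : Set
Outcome = Result × Result

o : Game → Outcome
o G = oᴸ G , oᴿ G

_≥ᵒ_ : Outcome → Outcome → Set
_≥ᵒ_ = Pointwise _≥ʳ_ _≥ʳ_

𝓛 𝓝 𝓟 𝓡 : Pred Game 0ℓ
𝓛 G = o G ≡ (𝐋 , 𝐋)
𝓝 G = o G ≡ (𝐋 , 𝐑)
𝓟 G = o G ≡ (𝐑 , 𝐋)
𝓡 G = o G ≡ (𝐑 , 𝐑)

NonTerminal : Pred Game 0ℓ
NonTerminal X = X ≢ ∞ × X ≢ ∞̄

defined : ∀ {G X} → NonTerminal X → Defined G X
defined (_ , X≢∞̄) ∞+∞̄ = X≢∞̄ refl
defined (X≢∞ , _) ∞̄+∞ = X≢∞ refl

_≥_ : Game → Game → Set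
G ≥ H = ∀ X (x : NonTerminal X) → o (G + X [ defined x ]) ≥ᵒ o (H + X [ defined x ])

{-# OPTIONS --safe #-}

-- If Left wins G moving second, she keeps G + X at least as good as X by
-- answering every Right move in G within G (or reaching ∞, which absorbs the
-- whole sum) and otherwise playing as in X.  The dual statement, that Right
-- wins G + X if he wins one summand moving second and the other in the same
-- role as in the sum, shows that adding 𝟎 (won by both players moving second)
-- cannot help Left: this bounds 𝟎 + X from above by X, and, tested on X = 𝟎,
-- rules out G ≥ 𝟎 for any G that Right wins moving first.
module Submission where

open import Defs
open import Data.Bool.Base using (if_then_else_)
open import Data.Fin.Base using (_↑ˡ_; _↑ʳ_)
open import Data.Fin.Properties using (any?)
open import Data.Nat.Base using (ℕ; suc)
open import Data.Product.Base using (_,_; proj₂; map₂)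
open import Data.Sum.Base using (inj₁; inj₂)
open import Data.Vec.Functional using (Vector; _++_)
open import Data.Vec.Functional.Properties using (lookup-++ˡ; lookup-++ʳ)
open import Data.Vec.Functional.Relation.Unary.All using (All)
open import Data.Vec.Functional.Relation.Unary.All.Properties using (++⁺)
open import Data.Vec.Functional.Relation.Unary.Any using (Any)
open import Function.Base using (_∘_)
open import Function.Bundles using (_⇔_; mk⇔)
open import Level using (Level)
open import Relation.Binary.PropositionalEquality
  using (_≡_; _≢_; refl; sym; trans; cong; subst)
open import Relation.Nullary using (¬_; Dec; yes; no; ⌊_⌋; contradiction)
open import Relation.Unary using (Pred; _∈_; _∪_)

private variable
  a p : Level
  A   : Set a
  P   : Set p
  k l m n : ℕ

if-then⁺ : {x y : A} (P? : Dec P) → P → (if ⌊ P? ⌋ then x else y) ≡ x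
if-then⁺ (yes _) _ = refl
if-then⁺ (no ¬p) p = contradiction p ¬p

-- The branches must differ for the value to reveal which one was taken.
if-then⁻ : {x y : A} → y ≢ x → (P? : Dec P) → (if ⌊ P? ⌋ then x else y) ≡ x → P
if-then⁻ _   (yes p) _  = p
if-then⁻ y≢x (no _)  eq = contradiction eq y≢x

if-else⁺ : {x y : A} (P? : Dec P) → ¬ P → (if ⌊ P? ⌋ then x else y) ≡ y
if-else⁺ (yes p) ¬p = contradiction p ¬p
if-else⁺ (no _)  _  = refl

if-else⁻ : {x y : A} → x ≢ y → (P? : Dec P) → (if ⌊ P? ⌋ then x else y) ≡ y → ¬ P
if-else⁻ x≢y (yes _) eq = contradiction eq x≢y
if-else⁻ _   (no ¬p) _  = ¬p

module _ (Q : Pred A p) (xs : Vector A m) (ys : Vector A n) where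

  Any-++⁺ˡ : Any Q xs → Any Q (xs ++ ys)
  Any-++⁺ˡ (i , q) = i ↑ˡ n , subst Q (sym (lookup-++ˡ xs ys i)) q

  Any-++⁺ʳ : Any Q ys → Any Q (xs ++ ys)
  Any-++⁺ʳ (i , q) = m ↑ʳ i , subst Q (sym (lookup-++ʳ xs ys i)) q

≢𝐑⇒≡𝐋 : ∀ {r} → r ≢ 𝐑 → r ≡ 𝐋
≢𝐑⇒≡𝐋 {𝐋} _   = refl
≢𝐑⇒≡𝐋 {𝐑} r≢𝐑 = contradiction refl r≢𝐑

≢𝐋⇒≡𝐑 : ∀ {r} → r ≢ 𝐋 → r ≡ 𝐑
≢𝐋⇒≡𝐑 {𝐋} r≢𝐋 = contradiction refl r≢𝐋
≢𝐋⇒≡𝐑 {𝐑} _   = refl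

𝐋-max : ∀ {r s} → r ≡ 𝐋 → r ≥ʳ s
𝐋-max {s = 𝐋} refl = ≥ʳ-refl
𝐋-max {s = 𝐑} refl = 𝐋≥𝐑

𝐑-min : ∀ {r s} → s ≡ 𝐑 → r ≥ʳ s
𝐑-min {𝐋} refl = 𝐋≥𝐑
𝐑-min {𝐑} refl = ≥ʳ-refl

module _ (Gᴸ : Vector Game (suc m)) (Gᴿ : Vector Game (suc n)) where

  oᴸ≡𝐋⁺ : Any (λ G → oᴿ G ≡ 𝐋) Gᴸ → oᴸ ⟨ Gᴸ ∣ Gᴿ ⟩ ≡ 𝐋
  oᴸ≡𝐋⁺ = if-then⁺ (any? λ i → oᴿ (Gᴸ i) ≟ 𝐋)

  oᴸ≡𝐋⁻ : oᴸ ⟨ Gᴸ ∣ Gᴿ ⟩ ≡ 𝐋 → Any (λ G → oᴿ G ≡ 𝐋) Gᴸ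
  oᴸ≡𝐋⁻ = if-then⁻ (λ ()) (any? λ i → oᴿ (Gᴸ i) ≟ 𝐋)

  oᴸ≡𝐑⁺ : All (λ G → oᴿ G ≡ 𝐑) Gᴸ → oᴸ ⟨ Gᴸ ∣ Gᴿ ⟩ ≡ 𝐑
  oᴸ≡𝐑⁺ all = if-else⁺ (any? λ i → oᴿ (Gᴸ i) ≟ 𝐋)
    λ (i , eq) → contradiction (trans (sym (all i)) eq) λ ()

  oᴸ≡𝐑⁻ : oᴸ ⟨ Gᴸ ∣ Gᴿ ⟩ ≡ 𝐑 → All (λ G → oᴿ G ≡ 𝐑) Gᴸ
  -- There are only two results, so refuting `𝐋` at each index leaves `𝐑` there.
  oᴸ≡𝐑⁻ eq i = ≢𝐋⇒≡𝐑 (if-else⁻ (λ ()) (any? λ i → oᴿ (Gᴸ i) ≟ 𝐋) eq ∘ (i ,_))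

  oᴿ≡𝐑⁺ : Any (λ G → oᴸ G ≡ 𝐑) Gᴿ → oᴿ ⟨ Gᴸ ∣ Gᴿ ⟩ ≡ 𝐑
  oᴿ≡𝐑⁺ = if-then⁺ (any? λ i → oᴸ (Gᴿ i) ≟ 𝐑)

  oᴿ≡𝐑⁻ : oᴿ ⟨ Gᴸ ∣ Gᴿ ⟩ ≡ 𝐑 → Any (λ G → oᴸ G ≡ 𝐑) Gᴿ
  oᴿ≡𝐑⁻ = if-then⁻ (λ ()) (any? λ i → oᴸ (Gᴿ i) ≟ 𝐑)

  oᴿ≡𝐋⁺ : All (λ G → oᴸ G ≡ 𝐋) Gᴿ → oᴿ ⟨ Gᴸ ∣ Gᴿ ⟩ ≡ 𝐋
  oᴿ≡𝐋⁺ all = if-else⁺ (any? λ i → oᴸ (Gᴿ i) ≟ 𝐑)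
    λ (i , eq) → contradiction (trans (sym (all i)) eq) λ ()

  oᴿ≡𝐋⁻ : oᴿ ⟨ Gᴸ ∣ Gᴿ ⟩ ≡ 𝐋 → All (λ G → oᴸ G ≡ 𝐋) Gᴿ
  oᴿ≡𝐋⁻ eq i = ≢𝐑⇒≡𝐋 (if-else⁻ (λ ()) (any? λ i → oᴸ (Gᴿ i) ≟ 𝐑) eq ∘ (i ,_))

module _ (Gᴸ : Vector Game (suc k)) (Gᴿ : Vector Game (suc l))
         (Xᴸ : Vector Game (suc m)) (Xᴿ : Vector Game (suc n)) where

  private
    G X : Game
    G = ⟨ Gᴸ ∣ Gᴿ ⟩
    X = ⟨ Xᴸ ∣ Xᴿ ⟩

    Gᴸ+X Gᴿ+X : Vector Game _
    Gᴸ+X i = Gᴸ i + X [ (λ ()) ]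
    Gᴿ+X i = Gᴿ i + X [ (λ ()) ]

    G+Xᴸ G+Xᴿ : Vector Game _
    G+Xᴸ j = G + Xᴸ j [ (λ ()) ]
    G+Xᴿ j = G + Xᴿ j [ (λ ()) ]

  oᴸ-+≡𝐋⁺ˡ : Any (λ H → oᴿ H ≡ 𝐋) Gᴸ+X → oᴸ (G + X [ (λ ()) ]) ≡ 𝐋
  oᴸ-+≡𝐋⁺ˡ = oᴸ≡𝐋⁺ (Gᴸ+X ++ G+Xᴸ) (Gᴿ+X ++ G+Xᴿ) ∘ Any-++⁺ˡ (λ H → oᴿ H ≡ 𝐋) Gᴸ+X G+Xᴸ

  oᴸ-+≡𝐋⁺ʳ : Any (λ H → oᴿ H ≡ 𝐋) G+Xᴸ → oᴸ (G + X [ (λ ()) ]) ≡ 𝐋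
  oᴸ-+≡𝐋⁺ʳ = oᴸ≡𝐋⁺ (Gᴸ+X ++ G+Xᴸ) (Gᴿ+X ++ G+Xᴿ) ∘ Any-++⁺ʳ (λ H → oᴿ H ≡ 𝐋) Gᴸ+X G+Xᴸ

  oᴸ-+≡𝐑⁺ : All (λ H → oᴿ H ≡ 𝐑) Gᴸ+X → All (λ H → oᴿ H ≡ 𝐑) G+Xᴸ →
            oᴸ (G + X [ (λ ()) ]) ≡ 𝐑
  oᴸ-+≡𝐑⁺ g x = oᴸ≡𝐑⁺ (Gᴸ+X ++ G+Xᴸ) (Gᴿ+X ++ G+Xᴿ)
    (++⁺ (λ H → oᴿ H ≡ 𝐑) {xs = Gᴸ+X} {ys = G+Xᴸ} g x)

  oᴿ-+≡𝐑⁺ˡ : Any (λ H → oᴸ H ≡ 𝐑) Gᴿ+X → oᴿ (G + X [ (λ ()) ]) ≡ 𝐑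
  oᴿ-+≡𝐑⁺ˡ = oᴿ≡𝐑⁺ (Gᴸ+X ++ G+Xᴸ) (Gᴿ+X ++ G+Xᴿ) ∘ Any-++⁺ˡ (λ H → oᴸ H ≡ 𝐑) Gᴿ+X G+Xᴿ

  oᴿ-+≡𝐑⁺ʳ : Any (λ H → oᴸ H ≡ 𝐑) G+Xᴿ → oᴿ (G + X [ (λ ()) ]) ≡ 𝐑
  oᴿ-+≡𝐑⁺ʳ = oᴿ≡𝐑⁺ (Gᴸ+X ++ G+Xᴸ) (Gᴿ+X ++ G+Xᴿ) ∘ Any-++⁺ʳ (λ H → oᴸ H ≡ 𝐑) Gᴿ+X G+Xᴿ

  oᴿ-+≡𝐋⁺ : All (λ H → oᴸ H ≡ 𝐋) Gᴿ+X → All (λ H → oᴸ H ≡ 𝐋) G+Xᴿ →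
            oᴿ (G + X [ (λ ()) ]) ≡ 𝐋
  oᴿ-+≡𝐋⁺ g x = oᴿ≡𝐋⁺ (Gᴸ+X ++ G+Xᴸ) (Gᴿ+X ++ G+Xᴿ)
    (++⁺ (λ H → oᴸ H ≡ 𝐋) {xs = Gᴿ+X} {ys = G+Xᴿ} g x)

mutual
  -- Whichever summand Right moves in becomes one that Left wins moving first, and the next two
  -- lemmas let her answer there. Clauses with `∞̄` are absent because both its outcomes are `𝐑`,
  -- against the hypotheses.
  oᴿ-+-𝐋 : ∀ G X .(d : Defined G X) → oᴿ G ≡ 𝐋 → oᴿ X ≡ 𝐋 → oᴿ (G + X [ d ]) ≡ 𝐋
  oᴿ-+-𝐋 ∞ ∞         _ _ _ = refl
  oᴿ-+-𝐋 ∞ ⟨ _ ∣ _ ⟩ _ _ _ = refl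
  oᴿ-+-𝐋 ⟨ _ ∣ _ ⟩ ∞ _ _ _ = refl
  oᴿ-+-𝐋 G@(⟨ Gᴸ ∣ Gᴿ ⟩) X@(⟨ Xᴸ ∣ Xᴿ ⟩) _ g x = oᴿ-+≡𝐋⁺ Gᴸ Gᴿ Xᴸ Xᴿ
    (λ i → oᴸ-+-𝐋ˡ (Gᴿ i) X (λ ()) (oᴿ≡𝐋⁻ Gᴸ Gᴿ g i) x)
    (λ j → oᴸ-+-𝐋ʳ G (Xᴿ j) (λ ()) g (oᴿ≡𝐋⁻ Xᴸ Xᴿ x j))

  -- Left makes her winning move in `G`, which leaves two summands that she wins moving second.
  oᴸ-+-𝐋ˡ : ∀ G X .(d : Defined G X) → oᴸ G ≡ 𝐋 → oᴿ X ≡ 𝐋 → oᴸ (G + X [ d ]) ≡ 𝐋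
  oᴸ-+-𝐋ˡ ∞ ∞         _ _ _ = refl
  oᴸ-+-𝐋ˡ ∞ ⟨ _ ∣ _ ⟩ _ _ _ = refl
  oᴸ-+-𝐋ˡ ⟨ _ ∣ _ ⟩ ∞ _ _ _ = refl
  oᴸ-+-𝐋ˡ ⟨ Gᴸ ∣ Gᴿ ⟩ X@(⟨ Xᴸ ∣ Xᴿ ⟩) _ g x =
    oᴸ-+≡𝐋⁺ˡ Gᴸ Gᴿ Xᴸ Xᴿ (map₂ (λ {i} gᵢ → oᴿ-+-𝐋 (Gᴸ i) X (λ ()) gᵢ x) (oᴸ≡𝐋⁻ Gᴸ Gᴿ g))

  -- The winning move is now in `X`; both versions are needed because Right may have moved in either
  -- summand.
  oᴸ-+-𝐋ʳ : ∀ G X .(d : Defined G X) → oᴿ G ≡ 𝐋 → oᴸ X ≡ 𝐋 → oᴸ (G + X [ d ]) ≡ 𝐋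
  oᴸ-+-𝐋ʳ ∞ ∞         _ _ _ = refl
  oᴸ-+-𝐋ʳ ∞ ⟨ _ ∣ _ ⟩ _ _ _ = refl
  oᴸ-+-𝐋ʳ ⟨ _ ∣ _ ⟩ ∞ _ _ _ = refl
  oᴸ-+-𝐋ʳ G@(⟨ Gᴸ ∣ Gᴿ ⟩) ⟨ Xᴸ ∣ Xᴿ ⟩ _ g x =
    oᴸ-+≡𝐋⁺ʳ Gᴸ Gᴿ Xᴸ Xᴿ (map₂ (λ {j} xⱼ → oᴿ-+-𝐋 G (Xᴸ j) (λ ()) g xⱼ) (oᴸ≡𝐋⁻ Xᴸ Xᴿ x))

mutual
  -- With the roles exchanged, Right answers each Left move in the summand where it was made. The
  -- absorbing end is now `∞̄`, and `∞` cannot occur since both its outcomes are `𝐋`.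
  oᴸ-+-𝐑 : ∀ G X .(d : Defined G X) → oᴸ G ≡ 𝐑 → oᴸ X ≡ 𝐑 → oᴸ (G + X [ d ]) ≡ 𝐑
  oᴸ-+-𝐑 ∞̄ ∞̄         _ _ _ = refl
  oᴸ-+-𝐑 ∞̄ ⟨ _ ∣ _ ⟩ _ _ _ = refl
  oᴸ-+-𝐑 ⟨ _ ∣ _ ⟩ ∞̄ _ _ _ = refl
  oᴸ-+-𝐑 G@(⟨ Gᴸ ∣ Gᴿ ⟩) X@(⟨ Xᴸ ∣ Xᴿ ⟩) _ g x = oᴸ-+≡𝐑⁺ Gᴸ Gᴿ Xᴸ Xᴿ
    (λ i → oᴿ-+-𝐑ˡ (Gᴸ i) X (λ ()) (oᴸ≡𝐑⁻ Gᴸ Gᴿ g i) x)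
    (λ j → oᴿ-+-𝐑ʳ G (Xᴸ j) (λ ()) g (oᴸ≡𝐑⁻ Xᴸ Xᴿ x j))

  oᴿ-+-𝐑ˡ : ∀ G X .(d : Defined G X) → oᴿ G ≡ 𝐑 → oᴸ X ≡ 𝐑 → oᴿ (G + X [ d ]) ≡ 𝐑
  oᴿ-+-𝐑ˡ ∞̄ ∞̄         _ _ _ = refl
  oᴿ-+-𝐑ˡ ∞̄ ⟨ _ ∣ _ ⟩ _ _ _ = refl
  oᴿ-+-𝐑ˡ ⟨ _ ∣ _ ⟩ ∞̄ _ _ _ = refl
  oᴿ-+-𝐑ˡ ⟨ Gᴸ ∣ Gᴿ ⟩ X@(⟨ Xᴸ ∣ Xᴿ ⟩) _ g x =
    oᴿ-+≡𝐑⁺ˡ Gᴸ Gᴿ Xᴸ Xᴿ (map₂ (λ {i} gᵢ → oᴸ-+-𝐑 (Gᴿ i) X (λ ()) gᵢ x) (oᴿ≡𝐑⁻ Gᴸ Gᴿ g))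

  -- Right starts in `X` and keeps `G` in reserve. For `G = 𝟎`, a Left move in the reserve reaches
  -- `∞̄` and ends the sum in his favour.
  oᴿ-+-𝐑ʳ : ∀ G X .(d : Defined G X) → oᴸ G ≡ 𝐑 → oᴿ X ≡ 𝐑 → oᴿ (G + X [ d ]) ≡ 𝐑
  oᴿ-+-𝐑ʳ ∞̄ ∞̄         _ _ _ = refl
  oᴿ-+-𝐑ʳ ∞̄ ⟨ _ ∣ _ ⟩ _ _ _ = refl
  oᴿ-+-𝐑ʳ ⟨ _ ∣ _ ⟩ ∞̄ _ _ _ = refl
  oᴿ-+-𝐑ʳ G@(⟨ Gᴸ ∣ Gᴿ ⟩) ⟨ Xᴸ ∣ Xᴿ ⟩ _ g x =
    oᴿ-+≡𝐑⁺ʳ Gᴸ Gᴿ Xᴸ Xᴿ (map₂ (λ {j} xⱼ → oᴸ-+-𝐑 G (Xᴿ j) (λ ()) g xⱼ) (oᴿ≡𝐑⁻ Xᴸ Xᴿ x))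

-- Each outcome of `X` decides one side of the comparison: if it is `𝐋`, then `G + X` has the top
-- result; if it is `𝐑`, then `𝟎 + X` has the bottom one.
≥𝟎⁺ : ∀ G → oᴿ G ≡ 𝐋 → G ≥ 𝟎
≥𝟎⁺ G g X nt = left , right
  where
  left : oᴸ (G + X [ defined nt ]) ≥ʳ oᴸ (𝟎 + X [ defined nt ])
  left with oᴸ X in x
  ... | 𝐋 = 𝐋-max (oᴸ-+-𝐋ʳ G X (defined nt) g x)
  -- Here `refl` proves `oᴸ 𝟎 ≡ 𝐑`, as the only Left option of `𝟎` is `∞̄`.
  ... | 𝐑 = 𝐑-min (oᴸ-+-𝐑 𝟎 X (defined nt) refl x)

  right : oᴿ (G + X [ defined nt ]) ≥ʳ oᴿ (𝟎 + X [ defined nt ])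
  right with oᴿ X in x
  ... | 𝐋 = 𝐋-max (oᴿ-+-𝐋 G X (defined nt) g x)
  ... | 𝐑 = 𝐑-min (oᴿ-+-𝐑ʳ 𝟎 X (defined nt) refl x)

≥𝟎⁻ : ∀ G → G ≥ 𝟎 → oᴿ G ≡ 𝐋
≥𝟎⁻ G G≥𝟎 = ≢𝐑⇒≡𝐋 λ g →
  -- `oᴿ (𝟎 + 𝟎)` computes to `𝐋`, so the comparison at `X = 𝟎` would give `𝐑 ≥ʳ 𝐋`, an empty type.
  contradiction (subst (_≥ʳ 𝐋) (oᴿ-+-𝐑ˡ G 𝟎 (defined nt) g refl) (proj₂ (G≥𝟎 𝟎 nt))) λ ()
  where
  nt : NonTerminal 𝟎
  nt = (λ ()) , λ ()

-- The first component of `o G` only selects between the two classes.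
𝓛∪𝓟⁺ : ∀ G → oᴿ G ≡ 𝐋 → G ∈ 𝓛 ∪ 𝓟
𝓛∪𝓟⁺ G g with oᴸ G
... | 𝐋 = inj₁ (cong (𝐋 ,_) g)
... | 𝐑 = inj₂ (cong (𝐑 ,_) g)

𝓛∪𝓟⁻ : ∀ G → G ∈ 𝓛 ∪ 𝓟 → oᴿ G ≡ 𝐋
𝓛∪𝓟⁻ _ (inj₁ G∈𝓛) = cong proj₂ G∈𝓛
𝓛∪𝓟⁻ _ (inj₂ G∈𝓟) = cong proj₂ G∈𝓟

theorem14 : (G : Game) → G ≥ 𝟎 ⇔ G ∈ 𝓛 ∪ 𝓟
theorem14 G = mk⇔ (𝓛∪𝓟⁺ G ∘ ≥𝟎⁻ G) (≥𝟎⁺ G ∘ 𝓛∪𝓟⁻ G)
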